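{- Let $G=(U,V,E)$ be a finite bipartite graph with $|U|\le |V|$, and suppose that for each vertex $u\in U\cup V$ a non-negative integer $ub_u$ is given which is an upper bound involving $u$ (i.e. every balanced biclique of $G$ containing $u$ has half-size at most $ub_u$). Let $v\in U\cup V$ and let $z_v$ be the largest integer such that there exist at least $z_v$ vertices $u\in N(v)$ with $ub_u\ge z_v$. Then $z_v$ is an upper bound on the half-size of a maximum balanced biclique involving $v$; that is, every balanced biclique $(A,B)$ of $G$ with $v\in A\cup B$ satisfies $|A|=|B|\le z_v$.
   Context: A bipartite graph $G=(U,V,E)$ has two disjoint finite vertex sets $U,V$ and an edge set $E\subseteq U\times V$ (edges written as unordered pairs $\{u,v\}$ with $u\in U$, $v\in V$). For a vertex $v$, $N(v)=\{u:\{v,u\}\in E\}$ is its set of neighbours. A biclique is a pair $(A,B)$ with $A\subseteq U$, $B\subseteq V$ such that $\{u,v\}\in E$ for all $u\in A$, $v\in B$. It is balanced if $|A|=|B|$, and its half-size is then $|A|$. -}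

module Defs where

open import Data.Empty using (⊥)
open import Data.Fin.Base using (Fin)
open import Data.Fin.Subset using (Subset; ∣_∣) renaming (_∈_ to _∈ₛ_)
open import Data.Integer.Base using (ℤ; +_; _≤_)
open import Data.List.Base using (length)
open import Data.List.Relation.Unary.All using (All)
open import Data.List.Relation.Unary.Unique.Propositional using (Unique)
open import Data.Nat.Base using (ℕ)
open import Data.Product.Base using (_×_; ∃-syntax)
open import Data.Sum.Base using (_⊎_; inj₁; inj₂)
open import Level using (0ℓ)
open import Relation.Binary.Core using (REL)
open import Relation.Binary.Definitions using (Decidable)
open import Relation.Binary.PropositionalEquality using (_≡_)
open import Relation.Unary using (Pred; _∈_)

-- The two sides are U = Fin m and V = Fin n.  Edges are decidable because
-- E is a subset of the finite set U × V.
record BipartiteGraph (m n : ℕ) : Set₁ where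
  field
    Edge  : REL (Fin m) (Fin n) 0ℓ
    edge? : Decidable Edge

-- The disjoint union U ∪ V.
Vertex : ℕ → ℕ → Set
Vertex m n = Fin m ⊎ Fin n

module _ {m n : ℕ} (G : BipartiteGraph m n) where
  open BipartiteGraph G

  N : Vertex m n → Pred (Vertex m n) 0ℓ
  N (inj₁ u) (inj₂ v) = Edge u v
  N (inj₂ v) (inj₁ u) = Edge u v
  N (inj₁ _) (inj₁ _) = ⊥
  N (inj₂ _) (inj₂ _) = ⊥

  record Biclique : Set where
    field
      A        : Subset m
      B        : Subset n
      complete : ∀ {u v} → u ∈ₛ A → v ∈ₛ B → Edge u v

  module _ (K : Biclique) where
    open Biclique K

    Balanced : Set
    Balanced = ∣ A ∣ ≡ ∣ B ∣

    -- Only meaningful when K is balanced.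
    halfSize : ℕ
    halfSize = ∣ A ∣

    Contains : Pred (Vertex m n) 0ℓ
    Contains (inj₁ u) = u ∈ₛ A
    Contains (inj₂ v) = v ∈ₛ B

  UpperBoundInvolving : Vertex m n → ℤ → Set
  UpperBoundInvolving v b =
    ∀ (K : Biclique) → Balanced K → Contains K v → + halfSize K ≤ b

-- At least z distinct elements satisfy P (trivially true for z ≤ 0).
AtLeast : {X : Set} → ℤ → Pred X 0ℓ → Set
AtLeast {X} z P = ∃[ xs ] Unique {A = X} xs × All P xs × z ≤ + length xs

IsLargest : Pred ℤ 0ℓ → ℤ → Set
IsLargest P z = z ∈ P × (∀ y → y ∈ P → y ≤ z)

{-# OPTIONS --safe #-}
-- If (A , B) is a balanced biclique of half-size k containing v, the side
-- opposite to v consists of k neighbours of v.  Each of them lies in (A , B),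
-- so its bound is at least k; hence k is a candidate for the maximum z_v.
module Submission where

open import Defs
open import Data.Bool.Base using (true; false)
open import Data.Fin.Base using (Fin; zero; suc)
open import Data.Fin.Properties using (suc-injective)
open import Data.Fin.Subset using (Subset; ∣_∣) renaming (_∈_ to _∈ₛ_)
open import Data.Integer.Base using (ℤ; +_) renaming (_≤_ to _≤ℤ_)
open import Data.Integer.Properties using (≤-reflexive)
open import Data.List.Base using (List; []; _∷_; length; map)
open import Data.List.Properties using (length-map)
open import Data.List.Relation.Unary.All as All using (All; []; _∷_)
import Data.List.Relation.Unary.All.Properties as All
open import Data.List.Relation.Unary.AllPairs using ([]; _∷_)
open import Data.List.Relation.Unary.Unique.Propositional using (Unique)
import Data.List.Relation.Unary.Unique.Propositional.Properties as Unique
open import Data.Nat.Base using (ℕ; _≤_)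
open import Data.Product.Base using (_×_; _,_)
open import Data.Sum.Base using (inj₁; inj₂)
open import Data.Sum.Properties using (inj₁-injective; inj₂-injective)
open import Data.Vec.Base using ([]; _∷_; here; there)
open import Function.Definitions using (Injective)
open import Level using (0ℓ)
open import Relation.Binary.PropositionalEquality using (_≡_; refl; sym; trans; cong; subst)
open import Relation.Unary using (Pred; _∈_)

-- `AtLeast` asks for a duplicate-free list as witness, whereas the sides of a biclique are bit
-- vectors; this enumeration passes from one to the other.
elements : ∀ {n} → Subset n → List (Fin n)
elements []          = []
elements (true  ∷ p) = zero ∷ map suc (elements p)
elements (false ∷ p) = map suc (elements p)

elements-unique : ∀ {n} (p : Subset n) → Unique (elements p)
elements-unique []          = []
elements-unique (true  ∷ p) =
  -- The new head `zero` differs from every `suc i`, whatever the tail is.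
  All.map⁺ (All.universal (λ _ ()) (elements p)) ∷ Unique.map⁺ suc-injective (elements-unique p)
elements-unique (false ∷ p) = Unique.map⁺ suc-injective (elements-unique p)

elements-∈ : ∀ {n} (p : Subset n) → All (_∈ₛ p) (elements p)
elements-∈ []          = []
elements-∈ (true  ∷ p) = here ∷ All.map⁺ (All.map there (elements-∈ p))
elements-∈ (false ∷ p) = All.map⁺ (All.map there (elements-∈ p))

length-elements : ∀ {n} (p : Subset n) → length (elements p) ≡ ∣ p ∣
length-elements []          = refl
length-elements (true  ∷ p) = cong ℕ.suc (trans (length-map suc (elements p)) (length-elements p))
length-elements (false ∷ p) = trans (length-map suc (elements p)) (length-elements p)

-- Injectivity of `f` keeps the listed images distinct, so none of the count is lost. With `f` an
-- injection into the disjoint union, one side of a biclique becomes a list of vertices.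
atLeast-image : ∀ {n} {X : Set} {P : Pred X 0ℓ} (p : Subset n) {f : Fin n → X} →
                Injective _≡_ _≡_ f → (∀ {i} → i ∈ₛ p → P (f i)) → AtLeast (+ ∣ p ∣) P
atLeast-image p {f} f-inj f∈P =
  map f (elements p) ,
  Unique.map⁺ f-inj (elements-unique p) ,
  All.map⁺ (All.map f∈P (elements-∈ p)) ,
  ≤-reflexive (cong +_ (sym (trans (length-map f (elements p)) (length-elements p))))

proposition3 : ∀ (m n : ℕ) (G : BipartiteGraph m n) → m ≤ n →
    ∀ (ub : Vertex m n → ℕ) → (∀ u → UpperBoundInvolving G u (+ ub u)) →
    ∀ (v : Vertex m n) (z : ℤ) →
    IsLargest (λ k → AtLeast k (λ u → u ∈ N G v × k ≤ℤ + ub u)) z →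
    UpperBoundInvolving G v z
proposition3 m n G _ ub ub-bound (inj₁ u) z (_ , z-max) K bal u∈A =
  -- The neighbours listed are those in `B`, so the count obtained is `∣ B ∣`. Balance turns it into
  -- `∣ A ∣`; the threshold on `ub` already is the half-size and stays fixed.
  z-max _ (subst (λ k → AtLeast (+ k) (λ w → w ∈ N G (inj₁ u) × + halfSize G K ≤ℤ + ub w)) (sym bal)
    (atLeast-image B inj₂-injective λ w∈B → complete u∈A w∈B , ub-bound (inj₂ _) K bal w∈B))
  where open Biclique K
proposition3 m n G _ ub ub-bound (inj₂ v) z (_ , z-max) K bal v∈B =
  -- Now the neighbours come from `A`, whose size is the half-size by definition, so the count needs
  -- no transport.
  z-max _ (atLeast-image A inj₁-injective λ w∈A → complete w∈A v∈B , ub-bound (inj₁ _) K bal w∈A)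
  where open Biclique K
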